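{- Let $p$ be a prime, let $K \ge 1$, $n \ge 1$ and $j$ be integers with $0 \le j \le n-1$, and let $N = Kp^n+1$. Suppose that $N \neq p^{3(n-j)}+1$ and that $p^j \ge p^{n-j} \ge (N-1)^{1/3}$. If there exist integers $a>1$ and $L$ such that: (i) $a^{Kp^{n-j-1}} \equiv L \pmod N$ and $L \not\equiv 1 \pmod N$, and (ii) $L^{p^{j+1}} \equiv 1 \pmod N$, then $N$ is prime. -}

module Defs where

open import Data.Nat using (ℕ)
open import Data.Integer using (ℤ; +_; _-_)
open import Data.Integer.Divisibility using (_∣_)
open import Relation.Nullary using (¬_)

infix 4 _≡_[mod_] _≢_[mod_]

_≡_[mod_] : ℤ → ℤ → ℕ → Set
x ≡ y [mod N ] = + N ∣ x - y

_≢_[mod_] : ℤ → ℤ → ℕ → Set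
x ≢ y [mod N ] = ¬ (x ≡ y [mod N ])

{-# OPTIONS --safe #-}
module Submission where

-- Let m = p^(j+1) and P = p^(n-j).  As L ≢ 1 but L^m ≡ 1 (mod N), some prime q ∣ N
-- divides 1 + L + ⋯ + L^(m-1), and q ∤ m forces L ≢ 1 (mod q).  Hence P divides the
-- order of a mod q, so q ≡ 1 (mod P), and N ≡ 1 (mod P) makes the cofactor ≡ 1 (mod P)
-- too.  If N is composite, N = (1 + u P)(1 + v P) with u, v ≥ 1; P² ∣ N - 1 gives
-- u + v = w P, and N - 1 ≤ P³ gives w + u v ≤ P ≤ w P = u + v ≤ 1 + u v ≤ w + u v,
-- so N - 1 = (w + u v) P² = P³, the excluded case.

open import Defs
open import Data.Nat using (ℕ; _+_; _*_; _∸_; _^_; _≤_; _≥_)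
open import Data.Nat.Primality using (Prime)
open import Data.Integer using (ℤ; 1ℤ)
open import Data.Integer as ℤ using ()
open import Data.Product using (∃₂; _×_)
open import Relation.Binary.PropositionalEquality using (_≡_; _≢_)

open import Data.Nat using (+-*-rawSemiring; zero; suc; _<_; z≤n; s≤s; NonZero; ≢-nonZero; ≢-nonZero⁻¹; >-nonZero; nonTrivial⇒n>1)
open import Data.Nat.Properties
open import Data.Nat.Divisibility
open import Data.Nat.GCD using (gcd; gcd[m,n]∣m; gcd[m,n]∣n; gcd[m,n]≢0; gcd-GCD; module Bézout)
open import Data.Nat.Coprimality using (Coprime; coprime-divisor; gcd≡1⇒coprime)
open import Data.Nat.Combinatorics using (_C_; nCn≡1; nC1≡n; nCk+nC[k+1]≡[n+1]C[k+1]; k>n⇒nCk≡0)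
open import Data.Nat.Primality using (euclidsLemma; prime⇒irreducible; prime⇒nonZero; prime⇒nonTrivial; ¬prime[1])
open import Data.Nat.Primality.Factorisation using (factorise)
open import Data.Nat.Tactic.RingSolver using (solve-∀)
open import Data.Integer using (+_; ∣_∣; 0ℤ)
import Data.Integer.Properties as ℤ
open import Data.Integer.Divisibility.Signed as ℤ∣ using (∣ᵤ⇒∣; ∣⇒∣ᵤ)
import Data.Integer.Tactic.RingSolver as ℤ-Solver
open import Data.Fin using (Fin; zero; suc; toℕ; inject₁; fromℕ)
open import Data.Fin.Properties using (toℕ<n; toℕ-inject₁; toℕ-fromℕ)
open import Data.List using ([]; _∷_)
open import Data.List.Relation.Unary.All using ([]; _∷_)
open import Data.Vec.Functional using (Vector; init; tail; last)
open import Data.Product using (∃; _,_; proj₁; proj₂)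
open import Data.Sum using (_⊎_; inj₁; inj₂; [_,_]′)
open import Function using (_∘_; id)
open import Relation.Nullary using (¬_; yes; no; contradiction)
open import Relation.Binary.PropositionalEquality using (refl; sym; trans; cong; cong₂; subst; module ≡-Reasoning)
open import Algebra.Properties.CommutativeSemiring.Binomial +-*-commutativeSemiring
  using (binomialTerm) renaming (theorem to binomial-theorem)
open import Algebra.Properties.Semiring.Sum +-*-semiring using (sum; sum-init-last)
import Algebra.Definitions.RawSemiring +-*-rawSemiring as Raw

-- Fermat's little theorem

^≡^ : ∀ a n → a Raw.^ n ≡ a ^ n
^≡^ a zero    = refl
^≡^ a (suc n) = cong (a *_) (^≡^ a n)

×≡* : ∀ n a → n Raw.× a ≡ n * a
×≡* zero    a = refl
×≡* (suc n) a = cong (λ s → a + s) (×≡* n a)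

∣-sum : ∀ {d n} (t : Vector ℕ n) → (∀ i → d ∣ t i) → d ∣ sum t
∣-sum {n = zero}  t d∣t = _ ∣0
∣-sum {n = suc n} t d∣t = ∣m∣n⇒∣m+n (d∣t zero) (∣-sum (tail t) (d∣t ∘ suc))

-- The absorption identity, kept free of division so that Euclid's lemma applies to it. Induction
-- with Pascal's rule: it splits the upper row, then merges the lower one.
[k+1]*[n+1]C[k+1]≡[n+1]*nCk : ∀ n k → suc k * (suc n C suc k) ≡ suc n * (n C k)
[k+1]*[n+1]C[k+1]≡[n+1]*nCk n zero = begin
  1 * (suc n C 1)  ≡⟨ *-identityˡ _ ⟩
  suc n C 1        ≡⟨ nC1≡n (suc n) ⟩
  suc n            ≡⟨ *-identityʳ (suc n) ⟨
  suc n * 1        ∎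
  where open ≡-Reasoning
[k+1]*[n+1]C[k+1]≡[n+1]*nCk zero (suc k) = begin
  suc (suc k) * (1 C suc (suc k))  ≡⟨ cong (suc (suc k) *_) (k>n⇒nCk≡0 {1} {suc (suc k)} (s≤s (s≤s z≤n))) ⟩
  suc (suc k) * 0                  ≡⟨ *-zeroʳ (suc (suc k)) ⟩
  1 * 0                            ∎
  where open ≡-Reasoning
[k+1]*[n+1]C[k+1]≡[n+1]*nCk (suc n) (suc k) = begin
  suc (suc k) * (suc (suc n) C suc (suc k))  ≡⟨ cong (suc (suc k) *_) (nCk+nC[k+1]≡[n+1]C[k+1] (suc n) (suc k)) ⟨
  suc (suc k) * (x + y)                      ≡⟨ expand (suc k) x y ⟩
  x + suc k * x + suc (suc k) * y            ≡⟨ cong₂ (λ s t → x + s + t) ([k+1]*[n+1]C[k+1]≡[n+1]*nCk n k) ([k+1]*[n+1]C[k+1]≡[n+1]*nCk n (suc k)) ⟩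
  x + suc n * (n C k) + suc n * (n C suc k)  ≡⟨ collect x (suc n) (n C k) (n C suc k) ⟩
  x + suc n * (n C k + n C suc k)            ≡⟨ cong (λ s → x + suc n * s) (nCk+nC[k+1]≡[n+1]C[k+1] n k) ⟩
  suc (suc n) * x                            ∎
  where
  open ≡-Reasoning
  x = suc n C suc k
  y = suc n C suc (suc k)
  expand : ∀ k x y → suc k * (x + y) ≡ x + k * x + suc k * y
  expand = solve-∀
  collect : ∀ x n s t → x + n * s + n * t ≡ x + n * (s + t)
  collect = solve-∀

-- By absorption `q` divides `suc k * (q C suc k)`, and it is too large to divide `suc k`.
prime∣C : ∀ {q k} → Prime q → suc k < q → q ∣ q C suc k
prime∣C {suc q} {k} pq 1+k<q
  with euclidsLemma (suc k) (suc q C suc k) pq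
         (subst (suc q ∣_) (sym ([k+1]*[n+1]C[k+1]≡[n+1]*nCk q k)) (m∣m*n (q C k)))
... | inj₁ q∣1+k = contradiction (∣⇒≤ q∣1+k) (<⇒≱ 1+k<q)
... | inj₂ q∣C   = q∣C

[1+a]^q : ∀ {q} → Prime q → ∀ a → ∃ λ c → q ∣ c × suc a ^ q ≡ 1 + c + a ^ q
[1+a]^q {suc r} pq a = c , ∣-sum mid q∣mid , (begin
  suc a ^ q                ≡⟨ cong (_^ q) (+-comm 1 a) ⟩
  (a + 1) ^ q              ≡⟨ ^≡^ (a + 1) q ⟨
  (a + 1) Raw.^ q          ≡⟨ binomial-theorem q a 1 ⟩
  f zero + sum (tail f)    ≡⟨ cong (λ s → f zero + s) (sum-init-last (tail f)) ⟩
  f zero + (c + last (tail f)) ≡⟨ cong₂ (λ s t → s + (c + t)) first-term last-term ⟩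
  1 + (c + a ^ q)          ≡⟨ +-assoc 1 c _ ⟨
  1 + c + a ^ q            ∎)
  where
  open ≡-Reasoning
  q = suc r
  f : Vector ℕ (suc q)
  f = binomialTerm a 1 q
  mid : Vector ℕ r
  -- The binomial terms of index 1 to `q` - 1; the two outer ones are 1 and `a ^ q`.
  mid = init (tail f)
  c = sum mid
  term : ∀ i → f i ≡ (q C toℕ i) * a ^ toℕ i
  term i = begin
    f i                                             ≡⟨ ×≡* (q C toℕ i) _ ⟩
    (q C toℕ i) * (a Raw.^ toℕ i * 1 Raw.^ (q ∸ toℕ i)) ≡⟨ cong ((q C toℕ i) *_) (cong₂ _*_ (^≡^ a (toℕ i)) (^≡^ 1 (q ∸ toℕ i))) ⟩
    (q C toℕ i) * (a ^ toℕ i * 1 ^ (q ∸ toℕ i))     ≡⟨ cong (λ s → (q C toℕ i) * (a ^ toℕ i * s)) (^-zeroˡ (q ∸ toℕ i)) ⟩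
    (q C toℕ i) * (a ^ toℕ i * 1)                   ≡⟨ cong ((q C toℕ i) *_) (*-identityʳ _) ⟩
    (q C toℕ i) * a ^ toℕ i                         ∎
  first-term : f zero ≡ 1
  first-term = term zero
  last-term : last (tail f) ≡ a ^ q
  last-term = begin
    f (suc (fromℕ r))           ≡⟨ term (suc (fromℕ r)) ⟩
    (q C suc (toℕ (fromℕ r))) * a ^ suc (toℕ (fromℕ r)) ≡⟨ cong (λ s → (q C suc s) * a ^ suc s) (toℕ-fromℕ r) ⟩
    (q C q) * a ^ q             ≡⟨ cong (_* a ^ q) (nCn≡1 q) ⟩
    1 * a ^ q                   ≡⟨ *-identityˡ _ ⟩
    a ^ q                       ∎
  q∣mid : ∀ i → q ∣ mid i
  q∣mid i = subst (q ∣_) (sym (term (suc (inject₁ i))))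
    (∣m⇒∣m*n _ (prime∣C pq (s≤s (subst (_< r) (sym (toℕ-inject₁ i)) (toℕ<n i)))))

-- Induction on `a` through the binomial expansion. The multiple `c` of `q` is carried along so that
-- nothing is subtracted in ℕ.
a^q≡a+c : ∀ {q} → Prime q → ∀ a → ∃ λ c → q ∣ c × a ^ q ≡ a + c
a^q≡a+c {suc r} pq zero = 0 , _ ∣0 , refl
a^q≡a+c {q} pq (suc a)
  with c , q∣c , eq ← [1+a]^q pq a | d , q∣d , eq′ ← a^q≡a+c pq a
  = c + d , ∣m∣n⇒∣m+n q∣c q∣d , trans eq (trans (cong (λ s → 1 + c + s) eq′) (shuffle a c d))
  where
  shuffle : ∀ a c d → 1 + c + (a + d) ≡ 1 + a + (c + d)
  shuffle = solve-∀

-- Congruences of integers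

mod-reflexive : ∀ {N} x {y} → x ≡ y → x ≡ y [mod N ]
mod-reflexive {N} x refl = subst (λ z → N ∣ ∣ z ∣) (sym (ℤ.+-inverseʳ x)) (N ∣0)

mod-sym : ∀ {N} x y → x ≡ y [mod N ] → y ≡ x [mod N ]
mod-sym {N} x y = subst (N ∣_) (ℤ.∣i-j∣≡∣j-i∣ x y)

-- A congruence unfolds to divisibility of absolute values, which do not add up; the sum of
-- differences is therefore formed under signed divisibility.
mod-trans : ∀ {N} x y z → x ≡ y [mod N ] → y ≡ z [mod N ] → x ≡ z [mod N ]
mod-trans {N} x y z x≡y y≡z = ∣⇒∣ᵤ (subst (+ N ℤ∣.∣_) (telescope x y z)
  (ℤ∣.∣m∣n⇒∣m+n (∣ᵤ⇒∣ {i = x ℤ.- y} x≡y) (∣ᵤ⇒∣ {i = y ℤ.- z} y≡z)))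
  where
  telescope : ∀ x y z → (x ℤ.- y) ℤ.+ (y ℤ.- z) ≡ x ℤ.- z
  telescope = ℤ-Solver.solve-∀

mod-* : ∀ {N} x x′ y y′ → x ≡ x′ [mod N ] → y ≡ y′ [mod N ] → x ℤ.* y ≡ x′ ℤ.* y′ [mod N ]
mod-* {N} x x′ y y′ x≡x′ y≡y′ = ∣⇒∣ᵤ (subst (+ N ℤ∣.∣_) (telescope x x′ y y′)
  (ℤ∣.∣m∣n⇒∣m+n (ℤ∣.∣m⇒∣m*n y (∣ᵤ⇒∣ {i = x ℤ.- x′} x≡x′)) (ℤ∣.∣n⇒∣m*n x′ (∣ᵤ⇒∣ {i = y ℤ.- y′} y≡y′))))
  where
  telescope : ∀ x x′ y y′ → (x ℤ.- x′) ℤ.* y ℤ.+ x′ ℤ.* (y ℤ.- y′) ≡ x ℤ.* y ℤ.- x′ ℤ.* y′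
  telescope = ℤ-Solver.solve-∀

mod-^ : ∀ {N} x y → x ≡ y [mod N ] → ∀ m → x ℤ.^ m ≡ y ℤ.^ m [mod N ]
mod-^ x y x≡y zero    = mod-reflexive 1ℤ refl
mod-^ x y x≡y (suc m) = mod-* x y (x ℤ.^ m) (y ℤ.^ m) x≡y (mod-^ x y x≡y m)

mod-∣ : ∀ {M N} x y → M ∣ N → x ≡ y [mod N ] → x ≡ y [mod M ]
mod-∣ _ _ = ∣-trans

^-multiple≡1 : ∀ {N} x m k → x ℤ.^ m ≡ 1ℤ [mod N ] → x ℤ.^ (k * m) ≡ 1ℤ [mod N ]
^-multiple≡1 {N} x m k x^m≡1 =
  subst (λ z → z ≡ 1ℤ [mod N ]) (trans (ℤ.^-*-assoc x m k) (cong (x ℤ.^_) (*-comm m k)))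
    (subst (λ z → (x ℤ.^ m) ℤ.^ k ≡ z [mod N ]) (ℤ.^-zeroˡ k) (mod-^ (x ℤ.^ m) 1ℤ x^m≡1 k))

*-cancelʳ≡1 : ∀ {N} x y → x ℤ.* y ≡ 1ℤ [mod N ] → y ≡ 1ℤ [mod N ] → x ≡ 1ℤ [mod N ]
*-cancelʳ≡1 x y xy≡1 y≡1 = mod-trans x (x ℤ.* y) 1ℤ
  (mod-trans x (x ℤ.* 1ℤ) (x ℤ.* y) (mod-reflexive x (sym (ℤ.*-identityʳ x)))
    (mod-* x x 1ℤ y (mod-reflexive x refl) (mod-sym y 1ℤ y≡1)))
  xy≡1

-- Bézout over ℕ has two cases, g + t n = s m and g + s m = t n. In each, the power added to x^g is
-- itself 1 and cancels, so no inverse of `x` is involved.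
^-gcd≡1 : ∀ {N} x m n → x ℤ.^ m ≡ 1ℤ [mod N ] → x ℤ.^ n ≡ 1ℤ [mod N ] → x ℤ.^ gcd m n ≡ 1ℤ [mod N ]
^-gcd≡1 {N} x m n x^m≡1 x^n≡1 with Bézout.identity (gcd-GCD m n)
... | Bézout.+- s t eq = *-cancelʳ≡1 (x ℤ.^ gcd m n) (x ℤ.^ (t * n))
  (subst (λ z → z ≡ 1ℤ [mod N ]) (trans (cong (x ℤ.^_) (sym eq)) (ℤ.^-distribˡ-+-* x (gcd m n) (t * n)))
    (^-multiple≡1 x m s x^m≡1))
  (^-multiple≡1 x n t x^n≡1)
... | Bézout.-+ s t eq = *-cancelʳ≡1 (x ℤ.^ gcd m n) (x ℤ.^ (s * m))
  (subst (λ z → z ≡ 1ℤ [mod N ]) (trans (cong (x ℤ.^_) (sym eq)) (ℤ.^-distribˡ-+-* x (gcd m n) (s * m)))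
    (^-multiple≡1 x n t x^n≡1))
  (^-multiple≡1 x m s x^m≡1)

pos-^ : ∀ a n → + (a ^ n) ≡ (+ a) ℤ.^ n
pos-^ a zero    = refl
pos-^ a (suc n) = trans (ℤ.pos-* a (a ^ n)) (cong (λ z → + a ℤ.* z) (pos-^ a n))

-- The modulus is a successor so that the exponent q - 1 is `r`. Here `q` divides a^q - a = a (a^r -
-- 1), and Euclid's lemma removes the factor `a`.
fermat : ∀ {r} → Prime (suc r) → ∀ a → ¬ suc r ∣ a → (+ a) ℤ.^ r ≡ 1ℤ [mod suc r ]
fermat {r} pq a q∤a with c , q∣c , eq ← a^q≡a+c pq a
  = [ (λ q∣a → contradiction q∣a q∤a) , id ]′
      (euclidsLemma a ∣ (+ a) ℤ.^ r ℤ.- 1ℤ ∣ pq (subst (suc r ∣_) c≡ q∣c))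
  where
  open ≡-Reasoning
  cancel : ∀ x c → (x ℤ.+ c) ℤ.- x ≡ c
  cancel = ℤ-Solver.solve-∀
  factor : ∀ x y → x ℤ.* y ℤ.- x ≡ x ℤ.* (y ℤ.- 1ℤ)
  factor = ℤ-Solver.solve-∀
  c≡ : c ≡ a * ∣ (+ a) ℤ.^ r ℤ.- 1ℤ ∣
  c≡ = begin
    ∣ + c ∣                             ≡⟨ cong ∣_∣ (cancel (+ a) (+ c)) ⟨
    ∣ + (a + c) ℤ.- + a ∣               ≡⟨ cong (λ z → ∣ + z ℤ.- + a ∣) eq ⟨
    ∣ + (a ^ suc r) ℤ.- + a ∣           ≡⟨ cong (λ z → ∣ z ℤ.- + a ∣) (pos-^ a (suc r)) ⟩
    ∣ (+ a) ℤ.* (+ a) ℤ.^ r ℤ.- + a ∣   ≡⟨ cong ∣_∣ (factor (+ a) ((+ a) ℤ.^ r)) ⟩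
    ∣ + a ℤ.* ((+ a) ℤ.^ r ℤ.- 1ℤ) ∣    ≡⟨ ℤ.abs-* (+ a) _ ⟩
    a * ∣ (+ a) ℤ.^ r ℤ.- 1ℤ ∣          ∎

prime∧^≡1⇒∤ : ∀ {q} → Prime q → ∀ a m → .{{NonZero m}} → (+ a) ℤ.^ m ≡ 1ℤ [mod q ] → ¬ q ∣ a
prime∧^≡1⇒∤ {q} pq a (suc m) a^≡1 q∣a = ¬prime[1] (subst Prime (∣1⇒≡1 q∣1) pq)
  where
  a^≡0 : (+ a) ℤ.^ suc m ≡ 0ℤ [mod q ]
  a^≡0 = subst (λ z → q ∣ ∣ z ∣) (sym (ℤ.+-identityʳ ((+ a) ℤ.^ suc m)))
    (subst (q ∣_) (sym (ℤ.abs-* (+ a) ((+ a) ℤ.^ m))) (∣m⇒∣m*n _ q∣a))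
  q∣1 : q ∣ 1
  q∣1 = mod-trans 1ℤ ((+ a) ℤ.^ suc m) 0ℤ (mod-sym ((+ a) ℤ.^ suc m) 1ℤ a^≡1) a^≡0

-- Orders and prime divisors

prime∣^⇒∣ : ∀ {q} → Prime q → ∀ p m → q ∣ p ^ m → q ∣ p
prime∣^⇒∣ pq p zero    q∣1 = contradiction (subst Prime (∣1⇒≡1 q∣1) pq) ¬prime[1]
prime∣^⇒∣ pq p (suc m) q∣ with euclidsLemma p (p ^ m) pq q∣
... | inj₁ q∣p  = q∣p
... | inj₂ q∣p^ = prime∣^⇒∣ pq p m q∣p^

prime∤⇒coprime : ∀ {p d} → Prime p → ¬ p ∣ d → Coprime d p
prime∤⇒coprime pp p∤d (i∣d , i∣p) with prime⇒irreducible pp i∣p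
... | inj₁ i≡1 = i≡1
... | inj₂ i≡p = contradiction (subst (_∣ _) i≡p i∣d) p∤d

-- Divisors of p^n form a chain. If `p` divides `d`, one factor `p` is stripped from `d` and from
-- both powers; otherwise `d` is coprime to `p` and already divides the next lower power.
∣prime^ : ∀ {p d} → Prime p → ∀ n k → d ∣ p ^ n → (p ^ suc k ∣ d) ⊎ (d ∣ p ^ k)
∣prime^ pp zero k d∣1 = inj₂ (∣-trans d∣1 (1∣ _))
∣prime^ {p} {d} pp (suc n) k d∣ with p ∣? d
... | no p∤d = ∣prime^ pp n k (coprime-divisor (prime∤⇒coprime pp p∤d) d∣)
... | yes (divides e refl) with k
...   | zero  = inj₁ (subst (_∣ e * p) (sym (*-identityʳ p)) (n∣m*n e))
...   | suc k with ∣prime^ pp n k (*-cancelˡ-∣ p {{prime⇒nonZero pp}} (subst (_∣ p * p ^ n) (*-comm e p) d∣))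
...     | inj₁ p^∣e = inj₁ (subst (p * p ^ suc k ∣_) (*-comm p e) (*-monoʳ-∣ p p^∣e))
...     | inj₂ e∣p^ = inj₂ (subst (_∣ p * p ^ k) (*-comm p e) (*-monoʳ-∣ p e∣p^))

-- The gcd g of p^n and `m` stands in for the order of `x`: x^g is 1, so g cannot divide p^k, and by
-- the dichotomy p^(k+1) divides g.
p^[k+1]∣m : ∀ {N p} x k n m → Prime p → x ℤ.^ (p ^ k) ≢ 1ℤ [mod N ] →
            x ℤ.^ (p ^ n) ≡ 1ℤ [mod N ] → x ℤ.^ m ≡ 1ℤ [mod N ] → p ^ suc k ∣ m
p^[k+1]∣m {N} {p} x k n m pp x^p^k≢1 x^p^n≡1 x^m≡1
  with ∣prime^ pp n k (gcd[m,n]∣m (p ^ n) m)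
... | inj₁ p^∣g = ∣-trans p^∣g (gcd[m,n]∣n (p ^ n) m)
... | inj₂ (divides e eq) = contradiction
  (subst (λ z → x ℤ.^ z ≡ 1ℤ [mod N ]) (sym eq)
    (^-multiple≡1 x (gcd (p ^ n) m) e (^-gcd≡1 x (p ^ n) m x^p^n≡1 x^m≡1)))
  x^p^k≢1

-- The sum 1 + x + ⋯ + x^(m-1) in Horner form.
geometric : ℤ → ℕ → ℤ
geometric x zero    = 0ℤ
geometric x (suc m) = 1ℤ ℤ.+ x ℤ.* geometric x m

geometric-closed : ∀ x m → (x ℤ.- 1ℤ) ℤ.* geometric x m ≡ x ℤ.^ m ℤ.- 1ℤ
geometric-closed x zero    = ℤ.*-zeroʳ (x ℤ.- 1ℤ)
geometric-closed x (suc m) = begin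
  (x ℤ.- 1ℤ) ℤ.* (1ℤ ℤ.+ x ℤ.* geometric x m)          ≡⟨ expand x (geometric x m) ⟩
  x ℤ.- 1ℤ ℤ.+ x ℤ.* ((x ℤ.- 1ℤ) ℤ.* geometric x m)    ≡⟨ cong (λ z → x ℤ.- 1ℤ ℤ.+ x ℤ.* z) (geometric-closed x m) ⟩
  x ℤ.- 1ℤ ℤ.+ x ℤ.* (x ℤ.^ m ℤ.- 1ℤ)                  ≡⟨ collect x (x ℤ.^ m) ⟩
  x ℤ.* x ℤ.^ m ℤ.- 1ℤ                                 ∎
  where
  open ≡-Reasoning
  expand : ∀ x g → (x ℤ.- 1ℤ) ℤ.* (1ℤ ℤ.+ x ℤ.* g) ≡ x ℤ.- 1ℤ ℤ.+ x ℤ.* ((x ℤ.- 1ℤ) ℤ.* g)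
  expand = ℤ-Solver.solve-∀
  collect : ∀ x y → x ℤ.- 1ℤ ℤ.+ x ℤ.* (y ℤ.- 1ℤ) ≡ x ℤ.* y ℤ.- 1ℤ
  collect = ℤ-Solver.solve-∀

geometric≡ : ∀ {q} x m → x ≡ 1ℤ [mod q ] → geometric x m ≡ + m [mod q ]
geometric≡ x zero    x≡1 = mod-reflexive 0ℤ refl
geometric≡ {q} x (suc m) x≡1 = subst (λ z → q ∣ ∣ z ∣) (shift (x ℤ.* geometric x m) (+ m))
  (mod-* x 1ℤ (geometric x m) (+ m) x≡1 (geometric≡ x m x≡1))
  where
  shift : ∀ y m → y ℤ.- 1ℤ ℤ.* m ≡ (1ℤ ℤ.+ y) ℤ.- (1ℤ ℤ.+ m)
  shift = ℤ-Solver.solve-∀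

≢1⇒prime-divisor : ∀ n → .{{NonZero n}} → n ≢ 1 → ∃ λ q → Prime q × q ∣ n
≢1⇒prime-divisor n n≢1 with factorise n
... | record { factors = []     ; isFactorisation = eq } = contradiction eq n≢1
... | record { factors = q ∷ qs ; isFactorisation = eq ; factorsPrime = pq ∷ _ } =
  q , pq , subst (q ∣_) (sym eq) (m∣m*n _)

-- `N` divides (x - 1) G with G the geometric sum; were `N` and G coprime, `N` would divide x - 1.
-- So some prime `q` divides both, and `x` ≡ 1 mod `q` turns G into `m`.
^≡1⇒prime-divisor : ∀ N → .{{NonZero N}} → ∀ x m → x ≢ 1ℤ [mod N ] → x ℤ.^ m ≡ 1ℤ [mod N ] →
                    ∃ λ q → Prime q × q ∣ N × (x ≡ 1ℤ [mod q ] → q ∣ m)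
^≡1⇒prime-divisor N x m x≢1 x^m≡1 =
  q , pq , ∣-trans q∣g (gcd[m,n]∣m N G) , λ x≡1 →
    subst (q ∣_) (cong ∣_∣ (ℤ.+-identityʳ (+ m)))
      (mod-trans (+ m) (geometric x m) 0ℤ (mod-sym (geometric x m) (+ m) (geometric≡ x m x≡1))
        (subst (λ z → q ∣ ∣ z ∣) (sym (ℤ.+-identityʳ (geometric x m))) (∣-trans q∣g (gcd[m,n]∣n N G))))
  where
  G = ∣ geometric x m ∣
  N∣product : N ∣ G * ∣ x ℤ.- 1ℤ ∣
  N∣product = subst (N ∣_) (trans (sym (cong ∣_∣ (geometric-closed x m)))
    (trans (ℤ.abs-* (x ℤ.- 1ℤ) (geometric x m)) (*-comm _ G))) x^m≡1
  g≢1 : gcd N G ≢ 1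
  g≢1 g≡1 = x≢1 (coprime-divisor (gcd≡1⇒coprime g≡1) N∣product)
  divisor = ≢1⇒prime-divisor (gcd N G) {{≢-nonZero (gcd[m,n]≢0 N G (inj₁ (≢-nonZero⁻¹ N)))}} g≢1
  q = proj₁ divisor
  pq = proj₁ (proj₂ divisor)
  q∣g = proj₂ (proj₂ divisor)

-- Factorisations into factors congruent to 1

-- Expanding gives K P = (u + v) + u v P, so u + v = w P and K P² = (w + u v) P². It remains to
-- squeeze w + u v between `P` and `P`.
[1+uP][1+vP]≡1+KP²⇒KP²≡P³ : ∀ P K u v → .{{NonZero P}} → u ≥ 1 → v ≥ 1 →
  (1 + u * P) * (1 + v * P) ≡ 1 + K * (P * P) → K * (P * P) ≤ P * (P * P) →
  K * (P * P) ≡ P * (P * P)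
[1+uP][1+vP]≡1+KP²⇒KP²≡P³ P K (suc u) (suc v) _ _ eq bound
  = trans KP²≡ (cong (_* (P * P)) (≤-antisym w+UV≤P P≤w+UV))
  where
  open ≤-Reasoning
  U+V = suc u + suc v
  UV = suc u * suc v
  factor-P : ∀ P u v → (1 + u * P) * (1 + v * P) ≡ 1 + P * ((u + v) + u * v * P)
  factor-P = solve-∀
  regroup : ∀ P K → K * (P * P) ≡ P * (K * P)
  regroup = solve-∀
  K*P≡ : K * P ≡ U+V + UV * P
  K*P≡ = *-cancelˡ-≡ _ _ P (trans (sym (regroup P K))
    (suc-injective (trans (sym eq) (factor-P P (suc u) (suc v)))))
  P∣U+V : P ∣ U+V
  P∣U+V = ∣m+n∣m⇒∣n (subst (P ∣_) (trans K*P≡ (+-comm U+V _)) (n∣m*n K)) (n∣m*n UV)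
  w = quotient P∣U+V
  U+V≡wP : U+V ≡ w * P
  U+V≡wP = m∣n⇒n≡quotient*m P∣U+V
  expand : ∀ P u v → (1 + u * P) * (1 + v * P) ≡ 1 + ((u + v) * P + u * v * (P * P))
  expand = solve-∀
  collect : ∀ P w t → w * P * P + t * (P * P) ≡ (w + t) * (P * P)
  collect = solve-∀
  KP²≡ : K * (P * P) ≡ (w + UV) * (P * P)
  KP²≡ = trans (suc-injective (trans (sym eq) (expand P (suc u) (suc v))))
    (trans (cong (λ s → s * P + UV * (P * P)) U+V≡wP) (collect P w UV))
  w+UV≤P : w + UV ≤ P
  w+UV≤P = *-cancelʳ-≤ (w + UV) P (P * P) {{m*n≢0 P P}} (subst (_≤ P * (P * P)) KP²≡ bound)
  w≥1 : w ≥ 1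
  -- For w = 0 the sum `U+V`, a successor, would vanish.
  w≥1 = n≢0⇒n>0 λ w≡0 → contradiction (trans U+V≡wP (cong (_* P) w≡0)) λ ()
  -- The pattern variables are the predecessors of the two factors U and V: 1 + U V = U + V + (U -
  -- 1)(V - 1).
  surplus : ∀ u v → 1 + suc u * suc v ≡ (suc u + suc v) + u * v
  surplus = solve-∀
  P≤w+UV : P ≤ w + UV
  P≤w+UV = begin
    P          ≡⟨ *-identityˡ P ⟨
    1 * P      ≤⟨ *-monoˡ-≤ P w≥1 ⟩
    w * P      ≡⟨ U+V≡wP ⟨
    U+V        ≤⟨ m≤m+n U+V (u * v) ⟩
    U+V + u * v ≡⟨ surplus u v ⟨
    1 + UV     ≤⟨ +-monoˡ-≤ UV w≥1 ⟩
    w + UV     ∎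

cofactor : ∀ P K r m → P ∣ r → suc r * suc m ≡ 1 + K * P → P ∣ m
cofactor P K r m P∣r eq = ∣m+n∣m⇒∣n (subst (P ∣_) (sym r*m≡) (n∣m*n K)) (∣m⇒∣m*n (suc m) P∣r)
  where
  r*m≡ : r * suc m + m ≡ K * P
  r*m≡ = trans (+-comm (r * suc m) m) (suc-injective eq)

-- Case split on the quotient of N by the prime `suc q`: 0 is impossible, 1 makes N that prime, and
-- a larger one gives two nontrivial factors ≡ 1 mod `P`, which lead to the excluded equality.
prime-divisor≡1⇒prime : ∀ P K q → .{{NonZero P}} → Prime (suc q) → P ∣ q →
  suc q ∣ 1 + K * (P * P) → K * (P * P) ≤ P * (P * P) → K * (P * P) ≢ P * (P * P) →
  Prime (1 + K * (P * P))
prime-divisor≡1⇒prime P K zero pq = contradiction pq ¬prime[1]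
prime-divisor≡1⇒prime P K (suc q) pq P∣q (divides zero ()) bound excluded
prime-divisor≡1⇒prime P K (suc q) pq P∣q (divides 1 eq) bound excluded =
  subst Prime (trans (sym (*-identityˡ _)) (sym eq)) pq
prime-divisor≡1⇒prime P K r@(suc _) pq P∣r@(divides u r≡uP) (divides (suc m@(suc _)) eq) bound excluded
  -- Only N ≡ 1 mod `P` matters here, so K P² is read as (K P) P.
  with cofactor P (K * P) r m P∣r (trans (*-comm (suc r) (suc m)) (trans (sym eq) (cong suc (sym (*-assoc K P P)))))
... | divides v m≡vP = contradiction
  ([1+uP][1+vP]≡1+KP²⇒KP²≡P³ P K u v (positive u r≡uP) (positive v m≡vP)
    (trans (cong₂ (λ s t → suc s * suc t) (sym r≡uP) (sym m≡vP)) (trans (*-comm (suc r) (suc m)) (sym eq))) bound)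
  excluded
  where
  positive : ∀ {s} t → suc s ≡ t * P → t ≥ 1
  positive zero ()
  positive (suc t) _ = s≤s z≤n

-- With x = a^K and `q` the prime found from `L`, modulo `q` the power x^(p^k) is not 1, while
-- x^(p^n) and, by Fermat, x^(q-1) are. The additive form of `n` avoids truncated subtraction.
prime≡1[p^[k+1]] : ∀ p K n j k N → Prime p → K ≥ 1 → n ≡ k + (j + 1) → N ≡ 1 + K * p ^ n →
  ∀ a L → (+ a) ℤ.^ (K * p ^ k) ≡ L [mod N ] → L ≢ 1ℤ [mod N ] → L ℤ.^ (p ^ (j + 1)) ≡ 1ℤ [mod N ] →
  ∃ λ r → Prime (suc r) × (suc r ∣ N) × (p ^ suc k ∣ r)
prime≡1[p^[k+1]] p K n j k N pp K≥1 refl refl a L a^≡L L≢1 L^≡1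
  with ^≡1⇒prime-divisor N L (p ^ (j + 1)) L≢1 L^≡1
... | zero  , pq , _   , _ = contradiction refl (≢-nonZero⁻¹ 0 {{prime⇒nonZero pq}})
... | suc r , pq , q∣N , L≡1⇒q∣ = r , pq , q∣N ,
  p^[k+1]∣m x k n r pp x^p^k≢1 (subst (λ z → z ≡ 1ℤ [mod q ]) (sym (ℤ.^-*-assoc (+ a) K (p ^ n))) a^[K*p^n]≡1) x^r≡1
  where
  open ≡-Reasoning
  q = suc r
  x = (+ a) ℤ.^ K
  instance
    p≢0 : NonZero p
    p≢0 = prime⇒nonZero pp
    -- A positive exponent is what lets a^(K p^n) ≡ 1 show that `q` does not divide `a`.
    K*p^n≢0 : NonZero (K * p ^ n)
    K*p^n≢0 = m*n≢0 K (p ^ n) {{>-nonZero K≥1}} {{m^n≢0 p n}}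
  x^p^k≡L : x ℤ.^ (p ^ k) ≡ L [mod q ]
  x^p^k≡L = subst (λ z → z ≡ L [mod q ]) (sym (ℤ.^-*-assoc (+ a) K (p ^ k)))
    (mod-∣ ((+ a) ℤ.^ (K * p ^ k)) L q∣N a^≡L)
  exponent : K * p ^ k * p ^ (j + 1) ≡ K * p ^ n
  exponent = trans (*-assoc K (p ^ k) (p ^ (j + 1))) (cong (K *_) (sym (^-distribˡ-+-* p k (j + 1))))
  a^[K*p^n]≡1 : (+ a) ℤ.^ (K * p ^ n) ≡ 1ℤ [mod q ]
  a^[K*p^n]≡1 = mod-∣ ((+ a) ℤ.^ (K * p ^ n)) 1ℤ q∣N
    (subst (λ z → z ≡ 1ℤ [mod N ])
      (trans (ℤ.^-*-assoc (+ a) (K * p ^ k) (p ^ (j + 1))) (cong ((+ a) ℤ.^_) exponent))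
      (mod-trans (((+ a) ℤ.^ (K * p ^ k)) ℤ.^ (p ^ (j + 1))) (L ℤ.^ (p ^ (j + 1))) 1ℤ
        (mod-^ ((+ a) ℤ.^ (K * p ^ k)) L a^≡L (p ^ (j + 1))) L^≡1))
  -- Otherwise `q` divides K p^n = N - 1 as well as `N`.
  q∤p^[j+1] : ¬ q ∣ p ^ (j + 1)
  q∤p^[j+1] q∣ = ¬prime[1] (subst Prime (∣1⇒≡1 q∣1) pq)
    where
    q∣p^n : q ∣ p ^ n
    q∣p^n = subst (q ∣_) (sym (^-distribˡ-+-* p k (j + 1))) (∣n⇒∣m*n (p ^ k) q∣)
    q∣1 : q ∣ 1
    q∣1 = ∣m+n∣m⇒∣n (subst (q ∣_) (+-comm 1 (K * p ^ n)) q∣N) (∣n⇒∣m*n K q∣p^n)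
  x^p^k≢1 : x ℤ.^ (p ^ k) ≢ 1ℤ [mod q ]
  x^p^k≢1 x^≡1 = q∤p^[j+1] (L≡1⇒q∣
    (mod-trans L (x ℤ.^ (p ^ k)) 1ℤ (mod-sym (x ℤ.^ (p ^ k)) L x^p^k≡L) x^≡1))
  x^r≡1 : x ℤ.^ r ≡ 1ℤ [mod q ]
  x^r≡1 = subst (λ z → z ≡ 1ℤ [mod q ]) (sym (ℤ.^-*-assoc (+ a) K r))
    (^-multiple≡1 (+ a) r K (fermat pq a (prime∧^≡1⇒∤ pq a (K * p ^ n) a^[K*p^n]≡1)))

theorem3p1 : ∀ (p K n j N : ℕ) →
    Prime p → K ≥ 1 → n ≥ 1 → j ≤ n ∸ 1 →
    N ≡ K * p ^ n + 1 →
    N ≢ p ^ (3 * (n ∸ j)) + 1 →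
    p ^ j ≥ p ^ (n ∸ j) →
    (p ^ (n ∸ j)) ^ 3 ≥ N ∸ 1 →
    (∃₂ λ (a L : ℤ) →
    a ℤ.> 1ℤ ×
    (a ℤ.^ (K * p ^ (n ∸ j ∸ 1)) ≡ L [mod N ] × L ≢ 1ℤ [mod N ]) ×
    L ℤ.^ (p ^ (j + 1)) ≡ 1ℤ [mod N ]) →
    Prime N
theorem3p1 p K n j N pp K≥1 n≥1 j≤n-1 N≡ N≢ p^j≥P P³≥N-1 (+ a , L , _ , (a^≡L , L≢1) , L^≡1)
  = conclude (prime≡1[p^[k+1]] p K n j (n ∸ j ∸ 1) N pp K≥1 n≡k+[j+1]
      (trans N≡ (+-comm _ 1)) a L a^≡L L≢1 L^≡1)
  where
  open ≡-Reasoning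
  P = p ^ (n ∸ j)
  P≢0 : NonZero P
  P≢0 = m^n≢0 p (n ∸ j) {{prime⇒nonZero pp}}
  j<n : j < n
  -- Strictness rests on `n` ≥ 1: only then is `suc (n ∸ 1)` equal to `n`.
  j<n = subst (j <_) (m+[n∸m]≡n n≥1) (s≤s j≤n-1)
  1+k≡n∸j : suc (n ∸ j ∸ 1) ≡ n ∸ j
  1+k≡n∸j = m+[n∸m]≡n (m<n⇒0<n∸m j<n)
  n≡k+[j+1] : n ≡ n ∸ j ∸ 1 + (j + 1)
  n≡k+[j+1] = begin
    n                        ≡⟨ m∸n+n≡m (<⇒≤ j<n) ⟨
    n ∸ j + j                ≡⟨ cong (_+ j) 1+k≡n∸j ⟨
    suc (n ∸ j ∸ 1) + j      ≡⟨ +-suc (n ∸ j ∸ 1) j ⟨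
    n ∸ j ∸ 1 + suc j        ≡⟨ cong (λ i → n ∸ j ∸ 1 + i) (+-comm 1 j) ⟩
    n ∸ j ∸ 1 + (j + 1)      ∎
  n∸j≤j : n ∸ j ≤ j
  n∸j≤j = ≮⇒≥ λ j<n∸j → <⇒≱ (^-monoʳ-< p (nonTrivial⇒n>1 p {{prime⇒nonTrivial pp}}) j<n∸j) p^j≥P
  -- This is (N - 1) / P²: the exponent is n - 2(n - j), and n - j ≤ j keeps the subtraction exact.
  K′ = K * p ^ (j ∸ (n ∸ j))
  p^n≡ : p ^ n ≡ p ^ (j ∸ (n ∸ j)) * P * P
  p^n≡ = begin
    p ^ n                                ≡⟨ cong (p ^_) (m+[n∸m]≡n (<⇒≤ j<n)) ⟨
    p ^ (j + (n ∸ j))                    ≡⟨ ^-distribˡ-+-* p j (n ∸ j) ⟩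
    p ^ j * P                            ≡⟨ cong (λ i → p ^ i * P) (m∸n+n≡m n∸j≤j) ⟨
    p ^ (j ∸ (n ∸ j) + (n ∸ j)) * P      ≡⟨ cong (_* P) (^-distribˡ-+-* p (j ∸ (n ∸ j)) (n ∸ j)) ⟩
    p ^ (j ∸ (n ∸ j)) * P * P            ∎
  regroup : ∀ K e P → K * (e * P * P) + 1 ≡ 1 + K * e * (P * P)
  regroup = solve-∀
  N≡1+K′P² : N ≡ 1 + K′ * (P * P)
  N≡1+K′P² = begin
    N                                      ≡⟨ N≡ ⟩
    K * p ^ n + 1                          ≡⟨ cong (λ s → K * s + 1) p^n≡ ⟩
    K * (p ^ (j ∸ (n ∸ j)) * P * P) + 1    ≡⟨ regroup K (p ^ (j ∸ (n ∸ j))) P ⟩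
    1 + K′ * (P * P)                       ∎
  P^3≡ : P ^ 3 ≡ P * (P * P)
  P^3≡ = cong (λ s → P * (P * s)) (*-identityʳ P)
  conclude : (∃ λ r → Prime (suc r) × (suc r ∣ N) × (p ^ suc (n ∸ j ∸ 1) ∣ r)) → Prime N
  conclude (r , pq , q∣N , P∣r) = subst Prime (sym N≡1+K′P²)
      (prime-divisor≡1⇒prime P K′ r {{P≢0}} pq (subst (λ i → p ^ i ∣ r) 1+k≡n∸j P∣r) (subst (suc r ∣_) N≡1+K′P² q∣N)
        (subst (K′ * (P * P) ≤_) P^3≡ (subst (_≤ P ^ 3) (cong (_∸ 1) N≡1+K′P²) P³≥N-1))
        -- N - 1 = P³ is the value ruled out by hypothesis, since P³ = p^(3(n-j)).
        λ K′P²≡P³ → N≢ (begin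
          N                      ≡⟨ N≡1+K′P² ⟩
          1 + K′ * (P * P)       ≡⟨ cong suc K′P²≡P³ ⟩
          1 + P * (P * P)        ≡⟨ cong suc P^3≡ ⟨
          1 + P ^ 3              ≡⟨ +-comm 1 _ ⟩
          P ^ 3 + 1              ≡⟨ cong (_+ 1) (^-*-assoc p (n ∸ j) 3) ⟩
          p ^ ((n ∸ j) * 3) + 1  ≡⟨ cong (λ i → p ^ i + 1) (*-comm (n ∸ j) 3) ⟩
          p ^ (3 * (n ∸ j)) + 1  ∎))
theorem3p1 p K n j N pp K≥1 n≥1 j≤n-1 N≡ N≢ p^j≥P P³≥N-1 (ℤ.-[1+ _ ] , _ , () , _)
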